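{- Given a deterministic distributed algorithm $\mathcal{A}$ that computes a maximal matching in $N$-vertex hypergraphs of rank $3$ and maximum degree $d$ in $T(N,d)$ rounds, there is a deterministic distributed algorithm $\mathcal{B}$ that computes a $(2\Delta-1)$-edge-coloring of any $n$-node graph $G=(V,E)$ with maximum degree $\Delta$ in at most $T(3n\Delta,\,2\Delta-1)$ rounds.
   Context: All algorithms are in the LOCAL model: nodes of the (hyper)graph have unique identifiers of logarithmic length and initially know only their neighbors and incident (hyper)edges. Communication proceeds in synchronous rounds; in each round each node can send a message of arbitrary size on each of its (hyper)edges, which is delivered to all other endpoints of that (hyper)edge. At the end each node must know its own part of the solution (the matching hyperedges among its hyperedges, or the colors of its edges). The rank of a hypergraph is the maximum number of vertices in any of its hyperedges; the degree of a vertex is the number of hyperedges containing it. A matching in a hypergraph is a set of hyperedges no two of which share a vertex; it is maximal if no hyperedge can be added to it. A $k$-edge-coloring of a graph assigns one of $k$ colors to each edge so that any two edges sharing an endpoint get different colors. -}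

module Defs where

open import Data.Bool.Base using (Bool)
open import Data.Fin.Base using (Fin; toℕ)
open import Data.Fin.Properties using (_≟_)
open import Data.Fin.Subset
  using (Subset; _∈_; _∉_; _∩_; _∪_; ⁅_⁆; ∣_∣; Nonempty; Empty)
open import Data.Fin.Subset.Properties using (_∈?_)
open import Data.List.Base
  using (List; allFin; concatMap; filter; length; map)
open import Data.List.Extrema.Nat using (max)
import Data.List.Relation.Binary.Lex.NonStrict as Lex
import Data.List.Sort as Sort
open import Data.Nat.Base using (ℕ; zero; suc; _*_; _^_; _≤_; _<_)
open import Data.Nat.Logarithm using (⌈log₂_⌉)
open import Data.Nat.Properties using (≤-decTotalOrder)
open import Data.Product.Base using (Σ-syntax; _×_; _,_)
open import Data.Vec.Base using (lookup)
open import Function.Definitions using (Injective)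
import Relation.Binary.Construct.On as On
open import Relation.Binary.PropositionalEquality.Core using (_≡_; _≢_)
open import Relation.Nullary.Decidable.Core using (¬?)
open import Relation.Nullary.Negation.Core using (¬_)

------------------------------------------------------------------------
-- Hypergraphs and graphs

-- A set of nonempty hyperedges on the vertex set Fin n.  Injectivity of
-- `edge` says that there are no parallel hyperedges.

record Hypergraph (n : ℕ) : Set where
  field
    size     : ℕ
    edge     : Fin size → Subset n
    distinct : Injective _≡_ _≡_ edge
    nonempty : ∀ e → Nonempty (edge e)

  incident : Fin n → List (Fin size)
  incident v = filter (λ e → v ∈? edge e) (allFin size)

  degree : Fin n → ℕ
  degree v = length (incident v)

  maxDegree : ℕ
  maxDegree = max 0 (map degree (allFin n))

  rank : ℕ
  rank = max 0 (map (λ e → ∣ edge e ∣) (allFin size))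

  Adjacent : Fin size → Fin size → Set
  Adjacent e f = e ≢ f × Nonempty (edge e ∩ edge f)

open Hypergraph

-- A finite simple graph is a hypergraph all of whose edges are
-- two-element sets.

IsGraph : ∀ {n} → Hypergraph n → Set
IsGraph G = ∀ e → ∣ edge G e ∣ ≡ 2

IsMatching : ∀ {n} (H : Hypergraph n) → Subset (size H) → Set
IsMatching H M =
  ∀ {e f} → e ∈ M → f ∈ M → e ≢ f → Empty (edge H e ∩ edge H f)

IsMaximalMatching : ∀ {n} (H : Hypergraph n) → Subset (size H) → Set
IsMaximalMatching H M =
  IsMatching H M × (∀ e → e ∉ M → ¬ IsMatching H (M ∪ ⁅ e ⁆))

IsEdgeColoring : ∀ {n} (G : Hypergraph n) (k : ℕ) →
                 (Fin (size G) → Fin k) → Set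
IsEdgeColoring G k χ = ∀ {e f} → Adjacent G e f → χ e ≢ χ f

------------------------------------------------------------------------
-- The LOCAL model

ID : Set
ID = ℕ

-- Unique identifiers of at most c · ⌈log₂ n⌉ bits.

record Identifiers (c n : ℕ) : Set where
  field
    id      : Fin n → ID
    unique  : Injective _≡_ _≡_ id
    bounded : ∀ v → id v < 2 ^ (c * ⌈log₂ n ⌉)

open Identifiers

-- Nodes know a hyperedge as the set of identifiers of its endpoints.
-- Such a set is represented by its increasing enumeration, so that
-- nothing beyond the set itself is revealed to the nodes.

Name : Set
Name = List ID

-- The code a node executes, for nodes producing a value in `Out` for each
-- of their hyperedges.  Internal computation and message size are
-- unrestricted.

record Algorithm (Out : Set) : Set₁ where
  field
    State   : Set
    Message : Set
    rounds  : ℕ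
    -- own identifier, incident hyperedges
    init    : ID → List Name → State
    -- the message sent on a given incident hyperedge
    send    : State → Name → Message
    -- each received message is labelled by the hyperedge on which it
    -- arrives and by its sender
    receive : State → List (Name × ID × Message) → State
    output  : State → Name → Out

module Execution {Out : Set} (A : Algorithm Out)
                 {n} (H : Hypergraph n) {c} (I : Identifiers c n) where
  open Algorithm A

  sortByID : List (Fin n) → List (Fin n)
  sortByID = Sort.sort (On.decTotalOrder ≤-decTotalOrder (id I))

  endpoints : Fin (size H) → List (Fin n)
  endpoints e = sortByID (filter (_∈? edge H e) (allFin n))

  name : Fin (size H) → Name
  name e = map (id I) (endpoints e)

  -- Sorting by name (lexicographically) hides the indexing of the
  -- hyperedges by Fin (size H).
  edgesOf : Fin n → List (Fin (size H))
  edgesOf v = Sort.sort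
    (On.decTotalOrder (Lex.≤-decTotalOrder ≤-decTotalOrder) name)
    (incident H v)

  inbox : (Fin n → State) → Fin n → List (Name × ID × Message)
  inbox σ v = concatMap
    (λ e → map (λ u → name e , id I u , send (σ u) (name e))
               (filter (λ u → ¬? (u ≟ v)) (endpoints e)))
    (edgesOf v)

  stateAfter : ℕ → Fin n → State
  stateAfter zero    v = init (id I v) (map name (edgesOf v))
  stateAfter (suc t) v = receive (stateAfter t v) (inbox (stateAfter t) v)

  -- Every endpoint of every hyperedge e ends up knowing s e.
  Outputs : (Fin (size H) → Out) → Set
  Outputs s = ∀ {v e} → v ∈ edge H e →
              output (stateAfter rounds v) (name e) ≡ s e

open Algorithm using (rounds)
open Execution using (Outputs)

-- The number of vertices and the maximum degree are global knowledge: an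
-- algorithm is a family of node programs indexed by these two parameters.
-- The number c is the constant in the length of the identifiers.

ComputesMaximalMatching :
  (c r : ℕ) → (ℕ → ℕ → Algorithm Bool) → (ℕ → ℕ → ℕ) → Set
ComputesMaximalMatching c r A T =
  ∀ N d (H : Hypergraph N) → rank H ≡ r → maxDegree H ≡ d →
  (I : Identifiers c N) →
  rounds (A N d) ≤ T N d ×
  Σ[ M ∈ Subset (size H) ]
    (IsMaximalMatching H M × Outputs (A N d) H I (lookup M))

-- Colors are output as natural numbers below k Δ, since an algorithm with
-- values in Fin 0 would not exist even for graphs without edges.

ComputesEdgeColoring :
  (c : ℕ) (k : ℕ → ℕ) → (ℕ → ℕ → Algorithm ℕ) → (ℕ → ℕ → ℕ) → Set
ComputesEdgeColoring c k B T =
  ∀ n Δ (G : Hypergraph n) → IsGraph G → maxDegree G ≡ Δ →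
  (I : Identifiers c n) →
  rounds (B n Δ) ≤ T n Δ ×
  Σ[ χ ∈ (Fin (size G) → Fin (k Δ)) ]
    (IsEdgeColoring G (k Δ) χ × Outputs (B n Δ) G I (λ e → toℕ (χ e)))

{-# OPTIONS --safe #-}

-- Put k = 2Δ − 1.  Take k disjoint copies of G and add, for every edge
-- e = {u , v}, a hub w_e, with the hyperedges {u_i , v_i , w_e} for i < k.  A
-- matching contains at most one of the k hyperedges at w_e, and a hyperedge
-- {u_i , v_i , w_e} can be blocked otherwise only by one of the at most 2Δ − 2
-- edges adjacent to e, each of which is matched in at most one copy.  Hence a
-- maximal matching contains exactly one hyperedge at w_e, and its index i is the
-- color of e.
--
-- Every vertex of the hypergraph is simulated by a node of G that shares all
-- edges underlying its hyperedges, and the identifiers of the hypergraph are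
-- functions of the names of the edges of G.  So the nodes know all they need
-- initially and the simulation costs no additional round: in each round a node
-- sends the states of the vertices it simulates to its neighbors.

module Submission where

open import Defs
open import Data.Bool.Base using (Bool; true; false; if_then_else_)
open import Data.Empty using (⊥; ⊥-elim)
open import Data.Fin.Base
  using (Fin; zero; suc; toℕ; fromℕ<; inject≤; combine; remQuot)
open import Data.Fin.Properties as Fin
  using (any?; toℕ<n; toℕ-fromℕ<; toℕ-inject≤; remQuot-combine; combine-remQuot;
         pigeonhole)
open import Data.Fin.Subset
  using (Subset; _∈_; _∉_; ∣_∣; _∪_; ⁅_⁆; inside; outside)
open import Data.Fin.Subset.Properties
  using (_∈?_; ⊆-antisym; drop-there; x∈p∪q⁻; x∈p∪q⁺; x∈⁅x⁆; x∈⁅y⁆⇒x≡y; x∈p∩q⁺;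
         x∈p∩q⁻)
open import Data.List.Base as List hiding (find; lookup; any; fromMaybe)
open import Data.List.Extrema.Nat using (max; max≈v⁺; max≤v⁺; xs≤max)
open import Data.List.Membership.DecPropositional using () renaming (_∈?_ to ∈-dec)
open import Data.List.Membership.Propositional
  using (find; lose)
  renaming (_∈_ to _∈ₗ_)
open import Data.List.Membership.Propositional.Properties
open import Data.List.Membership.Propositional.Properties.WithK
  using (unique∧set⇒bag)
import Data.List.Membership.Setoid.Properties as SetoidMembership
open import Data.List.Properties
  using (≡-dec; concatMap-map; filter-notAll; filter-some; length-++;
         length-filter; length-map; length-tabulate; map-∘; map-cong-local;
         map-tabulate)
open import Data.List.Relation.Binary.BagAndSetEquality using (∼bag⇒↭)
import Data.List.Relation.Binary.Lex.NonStrict as Lex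
import Data.List.Relation.Binary.Permutation.Homogeneous as Homogeneous
open import Data.List.Relation.Binary.Permutation.Propositional
  using (_↭_; ↭-sym; ↭⇒↭ₛ)
open import Data.List.Relation.Binary.Permutation.Propositional.Properties
  using (∈-resp-↭; ↭-length)
import Data.List.Relation.Binary.Permutation.Setoid.Properties as SetoidPermutation
import Data.List.Relation.Binary.Pointwise as Pointwise
open import Data.List.Relation.Binary.Subset.Propositional using (_⊆_)
open import Data.List.Relation.Unary.All as All using (All; []; _∷_)
import Data.List.Relation.Unary.All.Properties as All
open import Data.List.Relation.Unary.AllPairs using ([]; _∷_)
open import Data.List.Relation.Unary.Any as Any using (Any; here; there)
open import Data.List.Relation.Unary.Linked using ([]; [-]; _∷_)
open import Data.List.Relation.Unary.Sorted.TotalOrder using (Sorted)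
import Data.List.Relation.Unary.Sorted.TotalOrder.Properties as Sorted
open import Data.List.Relation.Unary.Unique.DecPropositional.Properties
  using (deduplicate-!)
open import Data.List.Relation.Unary.Unique.Propositional using (Unique)
import Data.List.Relation.Unary.Unique.Propositional.Properties as Unique
import Data.List.Sort as Sort
open import Data.Nat.Base
  using (ℕ; zero; suc; _+_; _*_; _∸_; _^_; _/_; _≤_; _<_; z≤n; s≤s; s≤s⁻¹;
         ⌊_/2⌋; ⌈_/2⌉; NonZero; >-nonZero)
open import Data.Nat.Divisibility using (n∣m*n)
open import Data.Nat.DivMod using (+-distrib-/-∣ˡ; m*n/n≡m; m<n⇒m/n≡0)
open import Data.Nat.Induction using (<-rec)
open import Data.Nat.Logarithm
  using (⌈log₂_⌉; ⌈log₂⌉-mono-≤; ⌈log₂⌈n/2⌉⌉≡⌈log₂n⌉∸1)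
open import Data.Nat.Properties as ℕ using (≤-decTotalOrder; ≤-totalOrder)
open import Data.Product.Base
  using (Σ-syntax; ∃-syntax; ∃₂; _×_; _,_; proj₁; proj₂)
open import Data.Sum.Base using (_⊎_; inj₁; inj₂)
open import Data.Unit.Base using (⊤; tt)
open import Data.Vec.Base using ([]; _∷_; here; there; lookup)
open import Data.Vec.Properties using ([]=⇒lookup; lookup⇒[]=)
open import Function.Base using (_∘_; id)
open import Function.Bundles using (mk⇔)
open import Function.Definitions using (Injective)
open import Relation.Binary.Bundles using (TotalOrder; DecTotalOrder)
import Relation.Binary.Construct.On as On
open import Relation.Binary.Definitions using (DecidableEquality)
open import Relation.Binary.PropositionalEquality
open import Relation.Nullary
open import Relation.Nullary.Decidable using (¬?)
open import Relation.Unary using (Pred; Decidable)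

open Hypergraph

-- Lists

module _ {a} {A : Set a} where

  Unique-resp-↭ : {xs ys : List A} → xs ↭ ys → Unique xs → Unique ys
  Unique-resp-↭ xs↭ys =
    SetoidPermutation.Unique-resp-↭ (setoid A) (↭⇒↭ₛ xs↭ys)

  lookup-injective : ∀ {xs : List A} → Unique xs →
                     ∀ i j → List.lookup xs i ≡ List.lookup xs j → i ≡ j
  lookup-injective (_ ∷ _) zero zero _ = refl
  lookup-injective (x∉ ∷ _) zero (suc j) eq = ⊥-elim (All.lookup x∉ (∈-lookup j) eq)
  lookup-injective (x∉ ∷ _) (suc i) zero eq = ⊥-elim (All.lookup x∉ (∈-lookup i) (sym eq))
  lookup-injective (_ ∷ xs!) (suc i) (suc j) eq = cong suc (lookup-injective xs! i j eq)

  index-injective : ∀ {x y} {xs : List A} (x∈ : x ∈ₗ xs) (y∈ : y ∈ₗ xs) →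
                    Any.index x∈ ≡ Any.index y∈ → x ≡ y
  index-injective = SetoidMembership.index-injective (setoid A)

  -- Sending each position of `xs` to the position of the same element in `ys` is injective.
  Unique∧⊆⇒length≤ : {xs ys : List A} → Unique xs → xs ⊆ ys → length xs ≤ length ys
  Unique∧⊆⇒length≤ xs! xs⊆ys = Fin.injective⇒≤ {f = λ i → Any.index (xs⊆ys (∈-lookup i))}
    λ {i} {j} eq → lookup-injective xs! i j (index-injective _ _ eq)

  map-filter : ∀ {b p q} {B : Set b} {P : Pred A p} {Q : Pred B q}
               (P? : Decidable P) (Q? : Decidable Q) (f : A → B) →
               (∀ {x} → P x → Q (f x)) → (∀ {x} → Q (f x) → P x) →
               ∀ xs → map f (filter P? xs) ≡ filter Q? (map f xs)
  map-filter P? Q? f to from [] = refl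
  map-filter P? Q? f to from (x ∷ xs) with P? x | Q? (f x)
  ... | yes p | yes q = cong (f x ∷_) (map-filter P? Q? f to from xs)
  ... | yes p | no ¬q = ⊥-elim (¬q (to p))
  ... | no ¬p | yes q = ⊥-elim (¬p (from q))
  ... | no ¬p | no ¬q = map-filter P? Q? f to from xs

module _ {a ℓ₁ ℓ₂} (O : TotalOrder a ℓ₁ ℓ₂) where
  open TotalOrder O using (_≈_; reflexive; module Eq) renaming (Carrier to A)

  -- Duplicate-free lists with the same elements are permutations of each other, and sorting removes
  -- the remaining freedom. Names are computed this way below: it suffices to compare members.
  Sorted∧Unique⇒≡ : (∀ {x y} → x ≈ y → x ≡ y) → {xs ys : List A} →
                    Sorted O xs → Sorted O ys → Unique xs → Unique ys →
                    xs ⊆ ys → ys ⊆ xs → xs ≡ ys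
  Sorted∧Unique⇒≡ ≈⇒≡ xs↗ ys↗ xs! ys! xs⊆ys ys⊆xs =
    Pointwise.Pointwise-≡⇒≡ (Pointwise.map ≈⇒≡ (Sorted.↗↭↗⇒≋ O xs↗ ys↗
      (Homogeneous.map Eq.reflexive
        (↭⇒↭ₛ (∼bag⇒↭ (unique∧set⇒bag xs! ys! (mk⇔ xs⊆ys ys⊆xs)))))))

-- Incidence and degrees in hypergraphs.

module _ {n} (H : Hypergraph n) where

  ∈-incident⁺ : ∀ {v e} → v ∈ edge H e → e ∈ₗ incident H v
  ∈-incident⁺ {v} {e} v∈e = ∈-filter⁺ (λ e → v ∈? edge H e) (∈-allFin e) v∈e

  ∈-incident⁻ : ∀ {v e} → e ∈ₗ incident H v → v ∈ edge H e
  ∈-incident⁻ {v} e∈ = proj₂ (∈-filter⁻ (λ e → v ∈? edge H e) {xs = allFin (size H)} e∈)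

  incident-unique : ∀ v → Unique (incident H v)
  incident-unique v = Unique.filter⁺ (λ e → v ∈? edge H e) (Unique.allFin⁺ (size H))

  degree≤maxDegree : ∀ v → degree H v ≤ maxDegree H
  degree≤maxDegree v =
    All.lookup (xs≤max 0 (map (degree H) (allFin n))) (∈-map⁺ (degree H) (∈-allFin v))

  maxDegree≡0⇒edgeless : maxDegree H ≡ 0 → ¬ Fin (size H)
  maxDegree≡0⇒edgeless Δ≡0 e = let v , v∈e = nonempty H e in
    ℕ.<⇒≱ (filter-some (λ f → v ∈? edge H f) (lose (∈-allFin e) v∈e))
      (subst (degree H v ≤_) Δ≡0 (degree≤maxDegree v))

  maxDegree≤size : maxDegree H ≤ size H
  maxDegree≤size = max≤v⁺ z≤n (All.map⁺ (All.tabulate {xs = allFin n} λ {v} _ → begin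
    degree H v                ≤⟨ length-filter (λ e → v ∈? edge H e) (allFin (size H)) ⟩
    length (allFin (size H))  ≡⟨ length-tabulate {n = size H} id ⟩
    size H                    ∎))
    where open ℕ.≤-Reasoning

length-filter-∈? : ∀ {n} (p : Subset n) → length (filter (_∈? p) (allFin n)) ≡ ∣ p ∣
length-filter-∈? [] = refl
length-filter-∈? {suc n} (b ∷ p) = begin
  length (filter (_∈? (b ∷ p)) (allFin (suc n)))
    ≡⟨ cong (λ xs → length (filter (_∈? (b ∷ p)) (zero ∷ xs))) (sym (map-tabulate id suc)) ⟩
  length (filter (_∈? (b ∷ p)) (zero ∷ map suc (allFin n)))
    ≡⟨ whole b ⟩
  ∣ b ∷ p ∣ ∎
  where
  open ≡-Reasoning
  rest : ∀ b → length (filter (_∈? (b ∷ p)) (map suc (allFin n))) ≡ ∣ p ∣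
  rest b = begin
    length (filter (_∈? (b ∷ p)) (map suc (allFin n)))
      ≡⟨ cong length (map-filter (_∈? p) (_∈? (b ∷ p)) suc there drop-there (allFin n)) ⟨
    length (map suc (filter (_∈? p) (allFin n)))
      ≡⟨ length-map suc (filter (_∈? p) (allFin n)) ⟩
    length (filter (_∈? p) (allFin n))
      ≡⟨ length-filter-∈? p ⟩
    ∣ p ∣ ∎
  whole : ∀ b → length (filter (_∈? (b ∷ p)) (zero ∷ map suc (allFin n))) ≡ ∣ b ∷ p ∣
  whole inside = cong suc (rest inside)
  whole outside = rest outside

-- Executions in the LOCAL model

nameOrder : DecTotalOrder _ _ _
nameOrder = Lex.≤-decTotalOrder ≤-decTotalOrder

-- An inbox expressed through identifiers and names alone, so that a node simulating the vertex with
-- identifier `y` can compute it.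
inboxFrom : ∀ {Out} (A : Algorithm Out) → let open Algorithm A in
            (ID → State) → ID → List Name → List (Name × ID × Message)
inboxFrom A state y = concatMap λ nm →
  map (λ z → nm , z , Algorithm.send A (state z) nm) (filter (λ z → ¬? (z ℕ.≟ y)) nm)

module ExecutionProperties {Out : Set} (A : Algorithm Out)
                           {n} (H : Hypergraph n) {c} (I : Identifiers c n) where
  open Execution A H I
  private module I = Identifiers I

  private
    idOrder = On.decTotalOrder ≤-decTotalOrder I.id
    edgeOrder = On.decTotalOrder nameOrder name

  ∈-endpoints⁺ : ∀ {u e} → u ∈ edge H e → u ∈ₗ endpoints e
  ∈-endpoints⁺ u∈e = ∈-resp-↭ (↭-sym (Sort.sort-↭ idOrder _)) (∈-filter⁺ _ (∈-allFin _) u∈e)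

  ∈-endpoints⁻ : ∀ {u e} → u ∈ₗ endpoints e → u ∈ edge H e
  ∈-endpoints⁻ u∈ = proj₂ (∈-filter⁻ _ {xs = allFin n} (∈-resp-↭ (Sort.sort-↭ idOrder _) u∈))

  endpoints-unique : ∀ e → Unique (endpoints e)
  endpoints-unique e = Unique-resp-↭
    (↭-sym (Sort.sort-↭ idOrder _)) (Unique.filter⁺ _ (Unique.allFin⁺ n))

  length-endpoints : ∀ e → length (endpoints e) ≡ ∣ edge H e ∣
  length-endpoints e = trans (↭-length (Sort.sort-↭ idOrder _)) (length-filter-∈? (edge H e))

  ∈-name⁺ : ∀ {u e} → u ∈ edge H e → I.id u ∈ₗ name e
  ∈-name⁺ u∈e = ∈-map⁺ I.id (∈-endpoints⁺ u∈e)

  ∈-name⁻ : ∀ {y e} → y ∈ₗ name e → ∃[ u ] (u ∈ edge H e × y ≡ I.id u)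
  ∈-name⁻ y∈ with u , u∈ , eq ← ∈-map⁻ I.id y∈ = u , ∈-endpoints⁻ u∈ , eq

  name-unique : ∀ e → Unique (name e)
  name-unique e = Unique.map⁺ I.unique (endpoints-unique e)

  name-sorted : ∀ e → Sorted ≤-totalOrder (name e)
  name-sorted e = Sorted.map⁺ (DecTotalOrder.totalOrder idOrder) ≤-totalOrder id
    (Sort.sort-↗ idOrder _)

  name-injective : ∀ {e f} → name e ≡ name f → e ≡ f
  name-injective {e} {f} eq = distinct H (⊆-antisym (sub eq) (sub (sym eq)))
    where
    sub : ∀ {e f} → name e ≡ name f → ∀ {u} → u ∈ edge H e → u ∈ edge H f
    sub {f = f} eq u∈ with u′ , u′∈ , id≡ ← ∈-name⁻ (subst (_ ∈ₗ_) eq (∈-name⁺ u∈)) =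
      subst (_∈ edge H f) (sym (I.unique id≡)) u′∈

  ∈-edgesOf⁺ : ∀ {v e} → v ∈ edge H e → e ∈ₗ edgesOf v
  ∈-edgesOf⁺ {v} v∈e = ∈-resp-↭ (↭-sym (Sort.sort-↭ edgeOrder _))
    (∈-filter⁺ (λ e → v ∈? edge H e) (∈-allFin _) v∈e)

  ∈-edgesOf⁻ : ∀ {v e} → e ∈ₗ edgesOf v → v ∈ edge H e
  ∈-edgesOf⁻ {v} e∈ = proj₂ (∈-filter⁻ (λ e → v ∈? edge H e) {xs = allFin (size H)}
    (∈-resp-↭ (Sort.sort-↭ edgeOrder _) e∈))

  names-unique : ∀ v → Unique (map name (edgesOf v))
  names-unique v = Unique.map⁺ name-injective
    (Unique-resp-↭ (↭-sym (Sort.sort-↭ edgeOrder _)) (Unique.filter⁺ _ (Unique.allFin⁺ (size H))))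

  names-sorted : ∀ v → Sorted (DecTotalOrder.totalOrder nameOrder) (map name (edgesOf v))
  names-sorted v = Sorted.map⁺ (DecTotalOrder.totalOrder edgeOrder)
    (DecTotalOrder.totalOrder nameOrder) id (Sort.sort-↗ edgeOrder _)

  -- Only endpoints of hyperedges at `v` send to `v`, so `state` has to be correct only at their
  -- identifiers.
  inbox≡ : ∀ σ v (state : ID → Algorithm.State A) →
           (∀ {u e} → v ∈ edge H e → u ∈ edge H e → state (I.id u) ≡ σ u) →
           inbox σ v ≡ inboxFrom A state (I.id v) (map name (edgesOf v))
  inbox≡ σ v state state≡ = begin
    inbox σ v
      ≡⟨ cong concat (map-cong-local (All.tabulate λ e∈ → messages≡ (∈-edgesOf⁻ e∈))) ⟩
    concatMap (λ e → messages (name e)) (edgesOf v)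
      ≡⟨ concatMap-map messages name (edgesOf v) ⟨
    inboxFrom A state (I.id v) (map name (edgesOf v)) ∎
    where
    open ≡-Reasoning
    open Algorithm A using (send)
    messages : Name → List (Name × ID × Algorithm.Message A)
    messages nm = map (λ z → nm , z , send (state z) nm) (filter (λ z → ¬? (z ℕ.≟ I.id v)) nm)

    messages≡ : ∀ {e} → v ∈ edge H e →
      map (λ u → name e , I.id u , send (σ u) (name e))
          (filter (λ u → ¬? (u Fin.≟ v)) (endpoints e))
        ≡ messages (name e)
    messages≡ {e} v∈e = begin
      map (λ u → name e , I.id u , send (σ u) (name e)) others
        ≡⟨ map-cong-local (All.tabulate λ u∈ → cong (λ s → name e , _ , send s (name e))
             (sym (state≡ v∈e (∈-endpoints⁻
               (proj₁ (∈-filter⁻ (λ u → ¬? (u Fin.≟ v)) {xs = endpoints e} u∈)))))) ⟩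
      map (λ u → name e , I.id u , send (state (I.id u)) (name e)) others
        ≡⟨ map-∘ others ⟩
      map (λ z → name e , z , send (state z) (name e)) (map I.id others)
        ≡⟨ cong (map _) (map-filter _ _ I.id
             (λ u≢v → u≢v ∘ I.unique) (λ id≢ → id≢ ∘ cong I.id) (endpoints e)) ⟩
      messages (name e) ∎
      where others = filter (λ u → ¬? (u Fin.≟ v)) (endpoints e)

  ∈-inbox⁺ : ∀ σ {u v e} → v ∈ edge H e → u ∈ edge H e → u ≢ v →
             (name e , I.id u , Algorithm.send A (σ u) (name e)) ∈ₗ inbox σ v
  ∈-inbox⁺ σ {v = v} {e} v∈e u∈e u≢v = ∈-concatMap⁺ _ (lose (∈-edgesOf⁺ v∈e)
    (∈-map⁺ (λ u → name e , I.id u , Algorithm.send A (σ u) (name e))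
      (∈-filter⁺ (λ u → ¬? (u Fin.≟ v)) (∈-endpoints⁺ u∈e) u≢v)))

  ∈-inbox⁻ : ∀ σ {v m} → m ∈ₗ inbox σ v →
             ∃[ e ] ∃[ u ] m ≡ (name e , I.id u , Algorithm.send A (σ u) (name e))
  ∈-inbox⁻ σ {v} m∈ =
    let e , _ , m∈e = find (∈-concatMap⁻ _ {xs = edgesOf v} m∈)
        u , _ , m≡ = ∈-map⁻ (λ u → name e , I.id u , Algorithm.send A (σ u) (name e)) m∈e
    in e , u , m≡

-- Arithmetic and pairing of indices.

[m*n+o]/n≡m : ∀ m {n o} .{{_ : NonZero n}} → o < n → (m * n + o) / n ≡ m
[m*n+o]/n≡m m {n} {o} o<n = begin
  (m * n + o) / n    ≡⟨ +-distrib-/-∣ˡ o (n∣m*n m) ⟩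
  m * n / n + o / n  ≡⟨ cong₂ _+_ (m*n/n≡m m n) (m<n⇒m/n≡0 o<n) ⟩
  m + 0              ≡⟨ ℕ.+-identityʳ m ⟩
  m                  ∎ where open ≡-Reasoning

max-≡ : ∀ {v xs} → v ∈ₗ xs → (∀ {x} → x ∈ₗ xs → x ≤ v) → max 0 xs ≡ v
max-≡ v∈xs xs≤v = max≈v⁺ v∈xs (All.tabulate xs≤v) z≤n

module _ {m n : ℕ} where
  abstract
    pair : Fin m → Fin n → Fin (m * n)
    pair = combine

    fst : Fin (m * n) → Fin m
    fst p = proj₁ (remQuot n p)

    snd : Fin (m * n) → Fin n
    snd p = proj₂ (remQuot {m} n p)

    fst-pair : ∀ i j → fst (pair i j) ≡ i
    fst-pair i j = cong proj₁ (remQuot-combine i j)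

    snd-pair : ∀ i j → snd (pair i j) ≡ j
    snd-pair i j = cong proj₂ (remQuot-combine {m} i j)

    pair-fst-snd : ∀ p → pair (fst p) (snd p) ≡ p
    pair-fst-snd = combine-remQuot {m} n

  pair-injective : ∀ {i i′ j j′} → pair i j ≡ pair i′ j′ → i ≡ i′ × j ≡ j′
  pair-injective {i} {i′} {j} {j′} eq =
    trans (sym (fst-pair i j)) (trans (cong fst eq) (fst-pair i′ j′)) ,
    trans (sym (snd-pair i j)) (trans (cong snd eq) (snd-pair i′ j′))

-- The j-th copy of the node with identifier a gets the identifier a K + j, and the
-- hub of an edge with identifiers a < b gets a K + (W + b).  With j < W and
-- W + b < K, the list below is increasing and division by K recovers the
-- identifier of the simulating node.
tripleName : (k W K : ℕ) → Name → ℕ → Name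
tripleName k W K (a ∷ b ∷ []) i = (a * K + i) ∷ (a * K + (W + b)) ∷ (b * K + i) ∷ []
tripleName k W K _            i = []

_∈?ₗ_ : (y : ID) (nm : Name) → Dec (y ∈ₗ nm)
_∈?ₗ_ = ∈-dec ℕ._≟_

_≟ₙ_ : DecidableEquality Name
_≟ₙ_ = ≡-dec ℕ._≟_

module _ (k W K : ℕ) where
  abstract
    tripleNames : List Name → ID → List Name
    -- Deduplication does not change the list on names of edges; it provides
    -- uniqueness without a proof that tripleName is injective on such names.
    tripleNames nms y = Sort.sort nameOrder (deduplicate _≟ₙ_
      (filter (λ t → y ∈?ₗ t) (cartesianProductWith (tripleName k W K) nms (upTo k))))

    tripleNames-sorted : ∀ nms y → Sorted (DecTotalOrder.totalOrder nameOrder) (tripleNames nms y)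
    tripleNames-sorted nms y = Sort.sort-↗ nameOrder _

    tripleNames-unique : ∀ nms y → Unique (tripleNames nms y)
    tripleNames-unique nms y = Unique-resp-↭
      (↭-sym (Sort.sort-↭ nameOrder _)) (deduplicate-! _≟ₙ_ _)

    ∈-tripleNames⁺ : ∀ {nms y nm j} → nm ∈ₗ nms → j < k → y ∈ₗ tripleName k W K nm j →
                     tripleName k W K nm j ∈ₗ tripleNames nms y
    ∈-tripleNames⁺ {y = y} nm∈ j<k y∈ = ∈-resp-↭ (↭-sym (Sort.sort-↭ nameOrder _))
      (∈-deduplicate⁺ _≟ₙ_ (∈-filter⁺ (λ t → y ∈?ₗ t)
        (∈-cartesianProductWith⁺ (tripleName k W K) nm∈ (∈-upTo⁺ j<k)) y∈))

    ∈-tripleNames⁻ : ∀ {nms y t} → t ∈ₗ tripleNames nms y →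
                     ∃[ nm ] ∃[ j ] (nm ∈ₗ nms × j < k × t ≡ tripleName k W K nm j × y ∈ₗ t)
    ∈-tripleNames⁻ {nms} {y} t∈ =
      let candidates = cartesianProductWith (tripleName k W K) nms (upTo k)
          t∈candidates , y∈t = ∈-filter⁻ (λ t → y ∈?ₗ t) {xs = candidates}
            (∈-deduplicate⁻ _≟ₙ_ (filter (λ t → y ∈?ₗ t) candidates)
              (∈-resp-↭ (Sort.sort-↭ nameOrder _) t∈))
          nm , j , nm∈ , j∈ , t≡ =
            ∈-cartesianProductWith⁻ (tripleName k W K) nms (upTo k) t∈candidates
      in nm , j , nm∈ , ∈-upTo⁻ j∈ , t≡ , y∈t

-- The two endpoints of an edge of a graph.

module Endpoints {Out : Set} (B : Algorithm Out) {n} (G : Hypergraph n) (graph : IsGraph G)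
                 {c} (I : Identifiers c n) where
  open Execution B G I
  open ExecutionProperties B G I
  module I = Identifiers I

  private
    twoElements : ∀ {a} {A : Set a} (xs : List A) → length xs ≡ 2 → ∃₂ λ x y → xs ≡ x ∷ y ∷ []
    twoElements (x ∷ y ∷ []) refl = x , y , refl

    abstract
      ends : ∀ e → ∃₂ λ u v → endpoints e ≡ u ∷ v ∷ []
      ends e = twoElements (endpoints e) (trans (length-endpoints e) (graph e))

  -- Since `endpoints` is sorted by identifier, both ends of an edge agree on which of them is `lo`;
  -- that end will own the hub.
  lo hi : Fin (size G) → Fin n
  lo e = proj₁ (ends e)
  hi e = proj₁ (proj₂ (ends e))

  endpoints≡ : ∀ e → endpoints e ≡ lo e ∷ hi e ∷ []
  endpoints≡ e = proj₂ (proj₂ (ends e))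

  name≡ : ∀ e → name e ≡ I.id (lo e) ∷ I.id (hi e) ∷ []
  name≡ e = cong (map I.id) (endpoints≡ e)

  lo∈ : ∀ e → lo e ∈ edge G e
  lo∈ e = ∈-endpoints⁻ (subst (lo e ∈ₗ_) (sym (endpoints≡ e)) (here refl))

  hi∈ : ∀ e → hi e ∈ edge G e
  hi∈ e = ∈-endpoints⁻ (subst (hi e ∈ₗ_) (sym (endpoints≡ e)) (there (here refl)))

  ∈⇒lo⊎hi : ∀ {u} e → u ∈ edge G e → u ≡ lo e ⊎ u ≡ hi e
  ∈⇒lo⊎hi e u∈e with subst (_ ∈ₗ_) (endpoints≡ e) (∈-endpoints⁺ u∈e)
  ... | here eq         = inj₁ eq
  ... | there (here eq) = inj₂ eq

  lo<hi : ∀ e → I.id (lo e) < I.id (hi e)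
  lo<hi e with subst (Sorted ≤-totalOrder) (name≡ e) (name-sorted e)
             | subst Unique (name≡ e) (name-unique e)
  ... | lo≤hi ∷ _ | (lo≢hi ∷ _) ∷ _ = ℕ.≤∧≢⇒< lo≤hi lo≢hi

  lo∧hi-injective : ∀ {e f} → lo e ≡ lo f → hi e ≡ hi f → e ≡ f
  lo∧hi-injective {e} {f} lo≡ hi≡ = name-injective
    (trans (name≡ e) (trans (cong₂ (λ u v → I.id u ∷ I.id v ∷ []) lo≡ hi≡) (sym (name≡ f))))

  lo∧hi⊆⇒≡ : ∀ {e f} → lo e ∈ edge G f → hi e ∈ edge G f →
             lo f ∈ edge G e → hi f ∈ edge G e → e ≡ f
  lo∧hi⊆⇒≡ {e} {f} a b c d = distinct G (⊆-antisym (sub a b) (sub c d))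
    where
    sub : ∀ {e f} → lo e ∈ edge G f → hi e ∈ edge G f → ∀ {u} → u ∈ edge G e → u ∈ edge G f
    sub {e} lo∈f hi∈f u∈e with ∈⇒lo⊎hi e u∈e
    ... | inj₁ refl = lo∈f
    ... | inj₂ refl = hi∈f

-- The hypergraph of triples

module Triples {Out : Set} (B : Algorithm Out) {n} (G : Hypergraph n) (graph : IsGraph G)
               {c} (I : Identifiers c n) (k W K : ℕ)
               (k≤W : k ≤ W)
               (degree≤ : ∀ v → k + degree G v ≤ W)
               (code<K : ∀ v → W + Identifiers.id I v < K)
               .{{K≢0 : NonZero K}} where
  open Execution B G I using (endpoints; edgesOf; name)
  open ExecutionProperties B G I
  open Endpoints B G graph I public

  -- The position of `e` in the incidence list of `lo e` separates hubs with the same owner, and the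
  -- offset `k` skips the copies.
  slot< : ∀ e → k + toℕ (Any.index (∈-incident⁺ G (lo∈ e))) < W
  slot< e = ℕ.<-≤-trans (ℕ.+-monoʳ-< k (toℕ<n _)) (degree≤ (lo e))

  abstract
    slot : Fin (size G) → Fin W
    slot e = fromℕ< (slot< e)

    k≤slot : ∀ e → k ≤ toℕ (slot e)
    k≤slot e = subst (k ≤_) (sym (toℕ-fromℕ< (slot< e))) (ℕ.m≤m+n k _)

    slot-injective : ∀ {e f} → lo e ≡ lo f → slot e ≡ slot f → e ≡ f
    slot-injective {e} {f} lo≡ slot≡ = go lo≡ (∈-incident⁺ G (lo∈ f)) (ℕ.+-cancelˡ-≡ k _ _
      (trans (sym (toℕ-fromℕ< (slot< e))) (trans (cong toℕ slot≡) (toℕ-fromℕ< (slot< f)))))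
      where
      -- Replacing `lo f` by a variable allows matching on the equation.
      go : ∀ {v} → lo e ≡ v → (f∈ : f ∈ₗ incident G v) →
           toℕ (Any.index (∈-incident⁺ G (lo∈ e))) ≡ toℕ (Any.index f∈) → e ≡ f
      go refl f∈ eq = index-injective _ f∈ (Fin.toℕ-injective eq)

  owner : Fin (n * W) → Fin n
  owner = fst

  -- The vertex with coordinates (v , s) is the s-th copy of v if s < k.  The
  -- coordinates with s ≥ k hold the hubs of the edges whose endpoint with the
  -- smaller identifier is v; all others are isolated vertices.
  copy : Fin n → Fin k → Fin (n * W)
  copy u i = pair u (inject≤ i k≤W)

  hub : Fin (size G) → Fin (n * W)
  hub e = pair (lo e) (slot e)

  copy-injective : ∀ {u v i j} → copy u i ≡ copy v j → u ≡ v × i ≡ j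
  copy-injective {u} {v} {i} {j} eq with u≡v , i≡j ← pair-injective eq =
    u≡v , Fin.toℕ-injective
      (trans (sym (toℕ-inject≤ i k≤W)) (trans (cong toℕ i≡j) (toℕ-inject≤ j k≤W)))

  hub-injective : ∀ {e f} → hub e ≡ hub f → e ≡ f
  hub-injective {e} {f} eq with lo≡ , slot≡ ← pair-injective eq =
    slot-injective lo≡ slot≡

  hub≢copy : ∀ {e u i} → hub e ≢ copy u i
  hub≢copy {e} {u} {i} eq with _ , slot≡ ← pair-injective eq =
    ℕ.<-irrefl refl (ℕ.≤-<-trans (k≤slot e)
      (subst (_< k) (sym (trans (cong toℕ slot≡) (toℕ-inject≤ i k≤W))) (toℕ<n i)))

  base : Fin (size G * k) → Fin (size G)
  base = fst

  color : Fin (size G * k) → Fin k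
  color = snd {size G}

  triple : Fin (size G) → Fin k → Subset (n * W)
  triple e i = ⁅ copy (lo e) i ⁆ ∪ (⁅ copy (hi e) i ⁆ ∪ ⁅ hub e ⁆)

  copy∈triple : ∀ {u e} i → u ∈ edge G e → copy u i ∈ triple e i
  copy∈triple {e = e} i u∈e with ∈⇒lo⊎hi e u∈e
  ... | inj₁ refl = x∈p∪q⁺ (inj₁ (x∈⁅x⁆ _))
  ... | inj₂ refl = x∈p∪q⁺ (inj₂ (x∈p∪q⁺ (inj₁ (x∈⁅x⁆ _))))

  hub∈triple : ∀ e i → hub e ∈ triple e i
  hub∈triple e i = x∈p∪q⁺ {p = ⁅ copy (lo e) i ⁆} (inj₂
    (x∈p∪q⁺ {p = ⁅ copy (hi e) i ⁆} (inj₂ (x∈⁅x⁆ _))))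

  data TripleView (e : Fin (size G)) (i : Fin k) : Fin (n * W) → Set where
    isLo  : TripleView e i (copy (lo e) i)
    isHi  : TripleView e i (copy (hi e) i)
    isHub : TripleView e i (hub e)

  tripleView : ∀ {e i x} → x ∈ triple e i → TripleView e i x
  tripleView {e} {i} x∈ with x∈p∪q⁻ ⁅ copy (lo e) i ⁆ _ x∈
  ... | inj₁ x∈lo rewrite x∈⁅y⁆⇒x≡y _ x∈lo = isLo
  ... | inj₂ x∈ with x∈p∪q⁻ ⁅ copy (hi e) i ⁆ _ x∈
  ... | inj₁ x∈hi rewrite x∈⁅y⁆⇒x≡y _ x∈hi = isHi
  ... | inj₂ x∈hub rewrite x∈⁅y⁆⇒x≡y _ x∈hub = isHub

  copy∈triple⁻ : ∀ {u j e i} → copy u j ∈ triple e i → u ∈ edge G e × j ≡ i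
  copy∈triple⁻ {u} {j} {e} {i} x∈ = go refl (tripleView x∈)
    where
    go : ∀ {x} → x ≡ copy u j → TripleView e i x → u ∈ edge G e × j ≡ i
    go eq isLo with refl , i≡ ← copy-injective eq = lo∈ e , sym i≡
    go eq isHi with refl , i≡ ← copy-injective eq = hi∈ e , sym i≡
    go eq isHub = ⊥-elim (hub≢copy eq)

  hub∈triple⁻ : ∀ {f e i} → hub f ∈ triple e i → f ≡ e
  hub∈triple⁻ {f} {e} {i} x∈ = go refl (tripleView x∈)
    where
    go : ∀ {x} → x ≡ hub f → TripleView e i x → f ≡ e
    go eq isLo = ⊥-elim (hub≢copy (sym eq))
    go eq isHi = ⊥-elim (hub≢copy (sym eq))
    go eq isHub = sym (hub-injective eq)

  -- This makes the simulation local: the owners of two vertices in a common triple are endpoints of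
  -- the same edge of `G`, hence equal or adjacent.
  owner∈ : ∀ {x e i} → x ∈ triple e i → owner x ∈ edge G e
  owner∈ {x} {e} x∈ with tripleView x∈
  ... | isLo  = subst (_∈ edge G e) (sym (fst-pair (lo e) _)) (lo∈ e)
  ... | isHi  = subst (_∈ edge G e) (sym (fst-pair (hi e) _)) (hi∈ e)
  ... | isHub = subst (_∈ edge G e) (sym (fst-pair (lo e) _)) (lo∈ e)

  -- The copies contained in a triple reveal both the endpoints of the edge and the index.
  triple-injective : ∀ {e f i j} → triple e i ≡ triple f j → e ≡ f × i ≡ j
  triple-injective {e} {f} {i} {j} eq =
    lo∧hi⊆⇒≡ (proj₁ (sub eq (lo∈ e))) (proj₁ (sub eq (hi∈ e)))
             (proj₁ (sub (sym eq) (lo∈ f))) (proj₁ (sub (sym eq) (hi∈ f))) ,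
    proj₂ (sub eq (lo∈ e))
    where
    sub : ∀ {e f i j u} → triple e i ≡ triple f j → u ∈ edge G e → u ∈ edge G f × i ≡ j
    sub {i = i} eq u∈e = copy∈triple⁻ (subst (_ ∈_) eq (copy∈triple i u∈e))

  H : Hypergraph (n * W)
  H = record
    { size     = size G * k
    ; edge     = λ h → triple (base h) (color h)
    ; distinct = λ {h} {h′} eq → let base≡ , color≡ = triple-injective eq in
        trans (sym (pair-fst-snd h)) (trans (cong₂ pair base≡ color≡) (pair-fst-snd h′))
    ; nonempty = λ h → hub (base h) , hub∈triple (base h) (color h)
    }

  edge-pair : ∀ e i → edge H (pair e i) ≡ triple e i
  edge-pair e i = cong₂ triple (fst-pair e i) (snd-pair e i)

  abstract
    hub? : ∀ x → Dec (∃[ e ] hub e ≡ x)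
    hub? x = any? (λ e → hub e Fin.≟ x)

  -- The number of a vertex among those of its owner. A hub is coded by the identifier of `hi e`
  -- rather than by its slot: slots depend on the indexing of edges by `Fin (size G)`, which nodes
  -- cannot see, whereas the identifier occurs in the name of the edge.
  code : Fin (n * W) → ℕ
  code x with hub? x
  ... | yes (e , _) = W + I.id (hi e)
  ... | no _        = toℕ (snd {n} x)

  code-hub : ∀ e → code (hub e) ≡ W + I.id (hi e)
  code-hub e with hub? (hub e)
  ... | yes (f , eq) = cong (λ f → W + I.id (hi f)) (hub-injective eq)
  ... | no ¬∃ = ⊥-elim (¬∃ (e , refl))

  code-copy : ∀ u i → code (copy u i) ≡ toℕ i
  code-copy u i with hub? (copy u i)
  ... | yes (f , eq) = ⊥-elim (hub≢copy eq)
  ... | no ¬∃ = trans (cong toℕ (snd-pair u _)) (toℕ-inject≤ i k≤W)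

  code< : ∀ x → code x < K
  code< x with hub? x
  ... | yes (e , _) = code<K (hi e)
  ... | no _ = ℕ.<-trans (toℕ<n (snd {n} x)) (ℕ.≤-<-trans (ℕ.m≤m+n W _) (code<K (owner x)))

  -- Codes of hubs are at least `W` and all others are below `W`. Two hubs with the same owner and
  -- code belong to edges with the same endpoints.
  code-injective : ∀ x y → owner x ≡ owner y → code x ≡ code y → x ≡ y
  code-injective x y o≡ c≡ with hub? x | hub? y
  ... | yes (e , refl) | yes (f , refl) = cong hub (lo∧hi-injective
          (trans (sym (fst-pair (lo e) _)) (trans o≡ (fst-pair (lo f) _)))
          (I.unique (ℕ.+-cancelˡ-≡ W _ _ c≡)))
  ... | yes (e , _) | no _ =
    ⊥-elim (ℕ.<-irrefl (sym c≡) (ℕ.<-≤-trans (toℕ<n (snd {n} y)) (ℕ.m≤m+n W _)))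
  ... | no _ | yes (f , _) =
    ⊥-elim (ℕ.<-irrefl c≡ (ℕ.<-≤-trans (toℕ<n (snd {n} x)) (ℕ.m≤m+n W _)))
  ... | no _ | no _ =
    trans (sym (pair-fst-snd x)) (trans (cong₂ pair o≡ (Fin.toℕ-injective c≡)) (pair-fst-snd y))

  idH : Fin (n * W) → ID
  idH x = I.id (owner x) * K + code x

  idH/K : ∀ x → idH x / K ≡ I.id (owner x)
  idH/K x = [m*n+o]/n≡m (I.id (owner x)) (code< x)

  idH-injective : Injective _≡_ _≡_ idH
  idH-injective {x} {y} eq = code-injective x y owner≡
    (ℕ.+-cancelˡ-≡ (I.id (owner x) * K) _ _
      (trans eq (cong (λ v → I.id v * K + code y) (sym owner≡))))
    where
    owner≡ : owner x ≡ owner y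
    owner≡ = I.unique (trans (sym (idH/K x)) (trans (cong (_/ K) eq) (idH/K y)))

  idH-copy : ∀ u i → idH (copy u i) ≡ I.id u * K + toℕ i
  idH-copy u i = cong₂ (λ v s → I.id v * K + s) (fst-pair u _) (code-copy u i)

  idH-hub : ∀ e → idH (hub e) ≡ I.id (lo e) * K + (W + I.id (hi e))
  idH-hub e = cong₂ (λ v s → I.id v * K + s) (fst-pair (lo e) _) (code-hub e)

  copyLo<hub : ∀ e i → idH (copy (lo e) i) < idH (hub e)
  copyLo<hub e i = subst₂ _<_ (sym (idH-copy (lo e) i)) (sym (idH-hub e))
    (ℕ.+-monoʳ-< (I.id (lo e) * K) (ℕ.<-≤-trans (toℕ<n i) (ℕ.≤-trans k≤W (ℕ.m≤m+n W _))))

  -- Each owner has a block of `K` consecutive numbers, and the block of `hi e` comes after that of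
  -- `lo e`.
  hub<copyHi : ∀ e i → idH (hub e) < idH (copy (hi e) i)
  hub<copyHi e i = subst₂ _<_ (sym (idH-hub e)) (sym (idH-copy (hi e) i)) (begin-strict
    I.id (lo e) * K + (W + I.id (hi e))  <⟨ ℕ.+-monoʳ-< (I.id (lo e) * K) (code<K (hi e)) ⟩
    I.id (lo e) * K + K                  ≡⟨ ℕ.+-comm _ K ⟩
    suc (I.id (lo e)) * K                ≤⟨ ℕ.*-monoˡ-≤ K (lo<hi e) ⟩
    I.id (hi e) * K                      ≤⟨ ℕ.m≤m+n _ (toℕ i) ⟩
    I.id (hi e) * K + toℕ i              ∎)
    where open ℕ.≤-Reasoning

  -- Names and initial knowledge in executions on the hypergraph.

  module TripleExecution {Out′ : Set} (A : Algorithm Out′) {c′}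
                         (idH-bounded : ∀ x → idH x < 2 ^ (c′ * ⌈log₂ n * W ⌉)) where

    IH : Identifiers c′ (n * W)
    IH = record { id = idH ; unique = idH-injective ; bounded = idH-bounded }

    module EH = Execution A H IH
    module PH = ExecutionProperties A H IH

    nameH≡ : ∀ h → EH.name h ≡ tripleName k W K (name (base h)) (toℕ (color h))
    nameH≡ h = begin
      EH.name h
        ≡⟨ Sorted∧Unique⇒≡ ≤-totalOrder id (PH.name-sorted h)
             (ℕ.<⇒≤ (copyLo<hub e i) ∷ ℕ.<⇒≤ (hub<copyHi e i) ∷ [-])
             (PH.name-unique h)
             ((ℕ.<⇒≢ (copyLo<hub e i) ∷ ℕ.<⇒≢ (ℕ.<-trans (copyLo<hub e i) (hub<copyHi e i)) ∷ [])
               ∷ (ℕ.<⇒≢ (hub<copyHi e i) ∷ []) ∷ [] ∷ [])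
             to from ⟩
      idH (copy (lo e) i) ∷ idH (hub e) ∷ idH (copy (hi e) i) ∷ []
        ≡⟨ cong₂ _∷_ (idH-copy (lo e) i)
             (cong₂ _∷_ (idH-hub e) (cong (_∷ []) (idH-copy (hi e) i))) ⟩
      tripleName k W K (I.id (lo e) ∷ I.id (hi e) ∷ []) (toℕ i)
        ≡⟨ cong (λ nm → tripleName k W K nm (toℕ i)) (name≡ e) ⟨
      tripleName k W K (name e) (toℕ i) ∎
      where
      open ≡-Reasoning
      e = base h
      i = color h
      to : ∀ {y} → y ∈ₗ EH.name h →
           y ∈ₗ idH (copy (lo e) i) ∷ idH (hub e) ∷ idH (copy (hi e) i) ∷ []
      to y∈ with x , x∈ , refl ← PH.∈-name⁻ y∈ with tripleView x∈
      ... | isLo  = here refl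
      ... | isHub = there (here refl)
      ... | isHi  = there (there (here refl))
      from : ∀ {y} → y ∈ₗ idH (copy (lo e) i) ∷ idH (hub e) ∷ idH (copy (hi e) i) ∷ [] →
             y ∈ₗ EH.name h
      from (here refl) = PH.∈-name⁺ {e = h} (copy∈triple i (lo∈ e))
      from (there (here refl)) = PH.∈-name⁺ {e = h} (hub∈triple e i)
      from (there (there (here refl))) = PH.∈-name⁺ {e = h} (copy∈triple i (hi∈ e))

    nameH-pair : ∀ e i → EH.name (pair e i) ≡ tripleName k W K (name e) (toℕ i)
    nameH-pair e i = trans (nameH≡ (pair e i))
      (cong₂ (λ e i → tripleName k W K (name e) (toℕ i)) (fst-pair e i) (snd-pair e i))

    -- The owner of `x` can compute the initial knowledge of `x` from its own. No hyperedge at `x`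
    -- is missed, by `owner∈`; none is added, since a triple name containing the identifier of `x`
    -- belongs to a hyperedge containing `x`.
    namesH≡ : ∀ x → map EH.name (EH.edgesOf x) ≡
                    tripleNames k W K (map name (edgesOf (owner x))) (idH x)
    namesH≡ x = Sorted∧Unique⇒≡ (DecTotalOrder.totalOrder nameOrder) Pointwise.Pointwise-≡⇒≡
      (PH.names-sorted x) (tripleNames-sorted k W K _ _)
      (PH.names-unique x) (tripleNames-unique k W K _ _)
      (to ∘ ∈-map⁻ EH.name) (from ∘ ∈-tripleNames⁻ k W K)
      where
      nms : List Name
      nms = map name (edgesOf (owner x))

      to : ∀ {t} → ∃[ h ] (h ∈ₗ EH.edgesOf x × t ≡ EH.name h) → t ∈ₗ tripleNames k W K nms (idH x)
      to (h , h∈ , refl) = subst (_∈ₗ tripleNames k W K nms (idH x)) (sym (nameH≡ h))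
        (∈-tripleNames⁺ k W K
          (∈-map⁺ name (∈-edgesOf⁺ (owner∈ (PH.∈-edgesOf⁻ h∈))))
          (toℕ<n (color h))
          (subst (idH x ∈ₗ_) (nameH≡ h) (PH.∈-name⁺ (PH.∈-edgesOf⁻ h∈))))

      fromTriple : ∀ e {j} (j<k : j < k) → idH x ∈ₗ tripleName k W K (name e) j →
                   tripleName k W K (name e) j ∈ₗ map EH.name (EH.edgesOf x)
      fromTriple e {j} j<k x∈t = subst (_∈ₗ map EH.name (EH.edgesOf x)) nm≡
        (∈-map⁺ EH.name (PH.∈-edgesOf⁺
          (x∈h (PH.∈-name⁻ {e = h} (subst (idH x ∈ₗ_) (sym nm≡) x∈t)))))
        where
        h = pair e (fromℕ< j<k)

        nm≡ : EH.name h ≡ tripleName k W K (name e) j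
        nm≡ = trans (nameH-pair e _) (cong (tripleName k W K (name e)) (toℕ-fromℕ< j<k))

        x∈h : ∃[ x′ ] (x′ ∈ edge H h × idH x ≡ idH x′) → x ∈ edge H h
        x∈h (x′ , x′∈ , id≡) = subst (_∈ edge H h) (sym (idH-injective id≡)) x′∈

      from : ∀ {t} → ∃[ nm ] ∃[ j ] (nm ∈ₗ nms × j < k × t ≡ tripleName k W K nm j × idH x ∈ₗ t) →
             t ∈ₗ map EH.name (EH.edgesOf x)
      from (nm , j , nm∈ , j<k , refl , x∈t) = go (∈-map⁻ name nm∈) x∈t
        where
        go : ∃[ e ] (e ∈ₗ edgesOf (owner x) × nm ≡ name e) → idH x ∈ₗ tripleName k W K nm j →
             tripleName k W K nm j ∈ₗ map EH.name (EH.edgesOf x)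
        go (e , _ , refl) = fromTriple e j<k

    -- The cardinality is the length of the name, which is already known to have three entries.
    ∣edgeH∣≡3 : ∀ h → ∣ edge H h ∣ ≡ 3
    ∣edgeH∣≡3 h = begin
      ∣ edge H h ∣             ≡⟨ PH.length-endpoints h ⟨
      length (EH.endpoints h)  ≡⟨ length-map idH (EH.endpoints h) ⟨
      length (EH.name h)       ≡⟨ cong length (nameH≡ h) ⟩
      length (tripleName k W K (name (base h)) (toℕ (color h)))
        ≡⟨ cong (λ nm → length (tripleName k W K nm (toℕ (color h)))) (name≡ (base h)) ⟩
      3 ∎
      where open ≡-Reasoning

    -- The argument guarantees that the maximum is attained; without hyperedges the rank would be 0.
    rank≡3 : Fin (size H) → rank H ≡ 3
    rank≡3 h = max-≡
      (subst (_∈ₗ map (λ h → ∣ edge H h ∣) (allFin _)) (∣edgeH∣≡3 h) (∈-map⁺ _ (∈-allFin h)))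
      λ x∈ → bound (∈-map⁻ _ x∈)
      where
      bound : ∀ {x} → ∃[ h ] (h ∈ₗ allFin _ × x ≡ ∣ edge H h ∣) → x ≤ 3
      bound (h , _ , refl) = ℕ.≤-reflexive (∣edgeH∣≡3 h)

  -- Degrees in the hypergraph.

  degree-hub : ∀ e → degree H (hub e) ≡ k
  degree-hub e = trans (ℕ.≤-antisym
      (Unique∧⊆⇒length≤ (incident-unique H (hub e)) λ {h} h∈ →
        subst (_∈ₗ hyperedges)
          (trans (cong (λ e → pair e (color h)) (hub∈triple⁻ (∈-incident⁻ H h∈))) (pair-fst-snd h))
          (∈-map⁺ (pair e) (∈-allFin (color h))))
      (Unique∧⊆⇒length≤ (Unique.map⁺ (λ eq → proj₂ (pair-injective eq)) (Unique.allFin⁺ k))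
        λ h∈ → from (∈-map⁻ (pair e) h∈)))
    (trans (length-map (pair e) (allFin k)) (length-tabulate id))
    where
    hyperedges = map (pair e) (allFin k)
    from : ∀ {h} → ∃[ i ] (i ∈ₗ allFin k × h ≡ pair e i) → h ∈ₗ incident H (hub e)
    from (i , _ , refl) = ∈-incident⁺ H
      (subst (hub e ∈_) (sym (edge-pair e i)) (hub∈triple e i))

  degree-copy : ∀ u i → degree H (copy u i) ≤ degree G u
  degree-copy u i = subst (degree H (copy u i) ≤_) (length-map _ (incident G u))
    (Unique∧⊆⇒length≤ (incident-unique H (copy u i)) λ {h} h∈ →
      let u∈ , i≡ = copy∈triple⁻ {e = base h} (∈-incident⁻ H h∈) in
      subst (_∈ₗ map (λ e → pair e i) (incident G u))
        (trans (cong (pair (base h)) i≡) (pair-fst-snd h))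
        (∈-map⁺ (λ e → pair e i) (∈-incident⁺ G u∈)))

  -- A vertex with an incident hyperedge lies in a triple and is therefore a copy or a hub; isolated
  -- vertices fall under the empty list.
  degreeH≤ : (∀ v → degree G v ≤ k) → ∀ x → degree H x ≤ k
  degreeH≤ degree≤k x = go (incident H x) refl
    where
    go : ∀ hs → incident H x ≡ hs → length hs ≤ k
    go [] _ = z≤n
    go (h ∷ hs) eq = subst (λ hs → length hs ≤ k) eq
      (bound (tripleView (∈-incident⁻ H (subst (h ∈ₗ_) (sym eq) (here refl)))))
      where
      bound : ∀ {e i x} → TripleView e i x → degree H x ≤ k
      bound isLo  = ℕ.≤-trans (degree-copy _ _) (degree≤k _)
      bound isHi  = ℕ.≤-trans (degree-copy _ _) (degree≤k _)
      bound isHub = ℕ.≤-reflexive (degree-hub _)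

  maxDegreeH≡k : Fin (size G) → (∀ v → degree G v ≤ k) → maxDegree H ≡ k
  maxDegreeH≡k e degree≤k = max-≡
    (subst (_∈ₗ map (degree H) (allFin _)) (degree-hub e) (∈-map⁺ (degree H) (∈-allFin (hub e))))
    λ x∈ → bound (∈-map⁻ (degree H) x∈)
    where
    bound : ∀ {d} → ∃[ x ] (x ∈ₗ allFin _ × d ≡ degree H x) → d ≤ k
    bound (x , _ , refl) = degreeH≤ degree≤k x

  -- From a maximal matching to an edge coloring.

  module _ {Δ} (degree≤Δ : ∀ v → degree G v ≤ Δ) (2Δ≤1+k : Δ + Δ ≤ suc k)
           {M : Subset (size H)} (M-maximal : IsMaximalMatching H M) where

    meet⇒≡ : ∀ {e f i j x} → pair e i ∈ M → pair f j ∈ M →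
             x ∈ triple e i → x ∈ triple f j → e ≡ f × i ≡ j
    meet⇒≡ {e} {f} {i} {j} {x} ei∈M fj∈M x∈ei x∈fj with pair e i Fin.≟ pair f j
    ... | yes eq = pair-injective eq
    ... | no ei≢fj = ⊥-elim (proj₁ M-maximal ei∈M fj∈M ei≢fj (x , x∈p∩q⁺
          (subst (x ∈_) (sym (edge-pair e i)) x∈ei , subst (x ∈_) (sym (edge-pair f j)) x∈fj)))

    neighbours : Fin (size G) → List (Fin (size G))
    neighbours e = others (incident G (lo e)) ++ others (incident G (hi e))
      where others = filter (λ f → ¬? (f Fin.≟ e))

    ∈-neighbours⁺ : ∀ {u e f} → u ∈ edge G e → u ∈ edge G f → f ≢ e → f ∈ₗ neighbours e
    ∈-neighbours⁺ {u} {e} {f} u∈e u∈f f≢e with ∈⇒lo⊎hi e u∈e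
    ... | inj₁ refl = ∈-++⁺ˡ (∈-filter⁺ (λ f → ¬? (f Fin.≟ e)) (∈-incident⁺ G u∈f) f≢e)
    ... | inj₂ refl = ∈-++⁺ʳ _ (∈-filter⁺ (λ f → ¬? (f Fin.≟ e)) (∈-incident⁺ G u∈f) f≢e)

    -- Removing `e` itself from the incidence lists of both endpoints leaves at most `Δ - 1` edges
    -- in each.
    length-neighbours : ∀ e → length (neighbours e) < k
    length-neighbours e = s≤s⁻¹ (begin
      2 + length (neighbours e)
        ≡⟨ cong (2 +_) (length-++ (others (incident G (lo e)))) ⟩
      2 + (length (others (incident G (lo e))) + length (others (incident G (hi e))))
        ≡⟨ cong suc (ℕ.+-suc _ _) ⟨
      suc (length (others (incident G (lo e)))) + suc (length (others (incident G (hi e))))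
        ≤⟨ ℕ.+-mono-≤ (fewer (lo∈ e)) (fewer (hi∈ e)) ⟩
      Δ + Δ
        ≤⟨ 2Δ≤1+k ⟩
      suc k ∎)
      where
      open ℕ.≤-Reasoning
      others = filter (λ f → ¬? (f Fin.≟ e))
      fewer : ∀ {u} → u ∈ edge G e → suc (length (others (incident G u))) ≤ Δ
      fewer {u} u∈e = ℕ.≤-trans
        (filter-notAll (λ f → ¬? (f Fin.≟ e)) (incident G u)
          (lose (∈-incident⁺ G u∈e) (λ e≢e → e≢e refl)))
        (degree≤Δ u)

    -- A matched hyperedge meeting `triple e i` in a copy has index `i` and an underlying edge that
    -- is `e` or adjacent to `e`; one meeting it in the hub has underlying edge `e`. The hypotheses
    -- exclude both.
    extension-matching : ∀ {e i} → (∀ j → pair e j ∉ M) →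
                         (∀ {f} → f ∈ₗ neighbours e → pair f i ∉ M) →
                         IsMatching H (M ∪ ⁅ pair e i ⁆)
    extension-matching {e} {i} e∉M free {g} {h} g∈ h∈ g≢h (x , x∈) =
      go (x∈p∪q⁻ M _ g∈) (x∈p∪q⁻ M _ h∈) (x∈p∩q⁻ (edge H g) (edge H h) x∈)
      where
      disjoint : ∀ {x g} → g ∈ M → x ∈ edge H g → TripleView e i x → ⊥
      blocked : ∀ {u g} → u ∈ edge G e → g ∈ M → copy u i ∈ edge H g → ⊥
      blocked {u} {g} u∈e g∈M x∈g =
        let u∈g , i≡ = copy∈triple⁻ {e = base g} x∈g
            gi∈M = subst (_∈ M) (sym (trans (cong (pair (base g)) i≡) (pair-fst-snd g))) g∈M
        in free (∈-neighbours⁺ u∈e u∈g λ g≡e → e∉M i (subst (λ e → pair e i ∈ M) g≡e gi∈M)) gi∈M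

      disjoint g∈M x∈g isLo = blocked (lo∈ e) g∈M x∈g
      disjoint g∈M x∈g isHi = blocked (hi∈ e) g∈M x∈g
      disjoint {g = g} g∈M x∈g isHub = e∉M (color g) (subst (_∈ M)
        (sym (trans (cong (λ e → pair e (color g)) (hub∈triple⁻ {e = base g} x∈g))
                    (pair-fst-snd g))) g∈M)

      new : ∀ {h} → h ∈ ⁅ pair e i ⁆ → x ∈ edge H h → TripleView e i x
      new h∈e x∈h = tripleView
        (subst (x ∈_) (trans (cong (edge H) (x∈⁅y⁆⇒x≡y _ h∈e)) (edge-pair e i)) x∈h)

      go : g ∈ M ⊎ g ∈ ⁅ pair e i ⁆ → h ∈ M ⊎ h ∈ ⁅ pair e i ⁆ → x ∈ edge H g × x ∈ edge H h → ⊥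
      go (inj₁ g∈M) (inj₁ h∈M) _           = proj₁ M-maximal g∈M h∈M g≢h (x , x∈)
      go (inj₁ g∈M) (inj₂ h∈e) (x∈g , x∈h) = disjoint g∈M x∈g (new h∈e x∈h)
      go (inj₂ g∈e) (inj₁ h∈M) (x∈g , x∈h) = disjoint h∈M x∈h (new g∈e x∈g)
      go (inj₂ g∈e) (inj₂ h∈e) _           =
        g≢h (trans (x∈⁅y⁆⇒x≡y _ g∈e) (sym (x∈⁅y⁆⇒x≡y _ h∈e)))

    -- Otherwise maximality gives, for each of the `k` indices, an adjacent edge matched at that
    -- index. There are fewer than `k` adjacent edges, so one of them blocks two indices, and its
    -- hub lies in two matched hyperedges.
    matchedColor : ∀ e → ∃[ i ] pair e i ∈ M
    matchedColor e with any? (λ i → pair e i ∈? M)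
    ... | yes matched = matched
    ... | no unmatched =
      let i , j , i<j , index≡ =
            pigeonhole (length-neighbours e) (λ i → Any.index (proj₁ (proj₂ (blocker i))))
      in ⊥-elim (ℕ.<⇒≢ i<j (cong toℕ (sameBlocker (blocker i) (blocker j) index≡)))
      where
      Blocker : Fin k → Set
      Blocker i = ∃[ f ] (f ∈ₗ neighbours e × pair f i ∈ M)

      e∉M : ∀ j → pair e j ∉ M
      e∉M j ej∈M = unmatched (j , ej∈M)

      blocker : ∀ i → Blocker i
      blocker i with Any.any? (λ f → pair f i ∈? M) (neighbours e)
      ... | yes blocked = find blocked
      ... | no free = ⊥-elim (proj₂ M-maximal (pair e i) (e∉M i)
                        (extension-matching e∉M λ f∈ fi∈M → free (lose f∈ fi∈M)))

      sameBlocker : ∀ {i j} ((_ , f∈ , _) : Blocker i) ((_ , f′∈ , _) : Blocker j) →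
                    Any.index f∈ ≡ Any.index f′∈ → i ≡ j
      sameBlocker {i} {j} (f , f∈ , fi∈M) (f′ , f′∈ , f′j∈M) index≡ =
        proj₂ (meet⇒≡ fi∈M f′j∈M (hub∈triple f i)
          (subst (λ f → hub f ∈ triple f′ j) (sym (index-injective f∈ f′∈ index≡))
            (hub∈triple f′ j)))

    matchedColor-unique : ∀ e {i} → pair e i ∈ M → i ≡ proj₁ (matchedColor e)
    matchedColor-unique e ei∈M = proj₂
      (meet⇒≡ ei∈M (proj₂ (matchedColor e)) (hub∈triple e _) (hub∈triple e _))

    -- Adjacent edges of the same color would have matched hyperedges sharing the copy of their
    -- common endpoint at that index.
    matchedColor-coloring : IsEdgeColoring G k (proj₁ ∘ matchedColor)
    matchedColor-coloring {e} {f} (e≢f , u , u∈) χ≡ = e≢f (proj₁ (meet⇒≡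
      (proj₂ (matchedColor e)) (subst (λ i → pair f i ∈ M) (sym χ≡) (proj₂ (matchedColor f)))
      (copy∈triple _ (proj₁ (x∈p∩q⁻ (edge G e) (edge G f) u∈)))
      (copy∈triple _ (proj₂ (x∈p∩q⁻ (edge G e) (edge G f) u∈)))))

-- Simulation

-- The result is `k` if no entry is true, so the function is total even for `k = 0`.
firstTrue : ∀ {k} → (Fin k → Bool) → ℕ
firstTrue {zero}  f = 0
firstTrue {suc k} f = if f zero then 0 else suc (firstTrue (f ∘ suc))

firstTrue-unique : ∀ {k} (f : Fin k → Bool) {i} → f i ≡ true →
                   (∀ {j} → f j ≡ true → j ≡ i) → firstTrue f ≡ toℕ i
firstTrue-unique {suc k} f {zero} fi _ rewrite fi = refl
firstTrue-unique {suc k} f {suc i} fi unique with f zero in f0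
... | true  with () ← unique f0
... | false = cong suc (firstTrue-unique (f ∘ suc) fi λ fj → Fin.suc-injective (unique fj))

module Simulation (k W K : ℕ) .{{K≢0 : NonZero K}} (A : Algorithm Bool) where
  private module A = Algorithm A

  -- `states` is total on identifiers, which spares the node from listing the vertices it owns; only
  -- its values at their identifiers are meaningful.
  record SimulationState : Set where
    field
      self   : ID
      names  : List Name
      states : ID → A.State
  open SimulationState

  -- The node simulating the vertex with identifier y has identifier y / K.
  reportedState : (ID → A.State) → List (Name × ID × (ID → A.State)) → ID → A.State
  reportedState own []                   y = own y
  reportedState own ((_ , u , τ) ∷ msgs) y with u ℕ.≟ y / K
  ... | yes _ = τ y
  ... | no  _ = reportedState own msgs y

  -- The first message from the owner of `y` decides, so all such messages have to be correct; the
  -- own state is used if there is none.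
  reportedState≡ : ∀ {own y s} msgs →
    All (λ (_ , u , τ) → u ≡ y / K → τ y ≡ s) msgs →
    own y ≡ s ⊎ Any (λ (_ , u , _) → u ≡ y / K) msgs →
    reportedState own msgs y ≡ s
  reportedState≡ [] _ (inj₁ own≡) = own≡
  reportedState≡ {y = y} ((_ , u , τ) ∷ msgs) (τ≡ ∷ τs≡) reported with u ℕ.≟ y / K | reported
  ... | yes u≡ | _                = τ≡ u≡
  ... | no  _  | inj₁ own≡        = reportedState≡ msgs τs≡ (inj₁ own≡)
  ... | no  u≢ | inj₂ (here u≡)   = ⊥-elim (u≢ u≡)
  ... | no  _  | inj₂ (there any) = reportedState≡ msgs τs≡ (inj₂ any)

  simulate : Algorithm ℕ
  simulate = record
    { State   = SimulationState
    ; Message = ID → A.State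
    ; rounds  = A.rounds
    ; init    = λ a nms → record
        { self = a ; names = nms ; states = λ y → A.init y (tripleNames k W K nms y) }
    ; send    = λ s _ → states s
    ; receive = λ s msgs → record s
        { states = λ y → A.receive (states s y)
            (inboxFrom A (reportedState (states s) msgs) y (tripleNames k W K (names s) y)) }
    -- Each endpoint consults its own copies, whose identifiers are `self s * K + toℕ i`, because
    -- the hub is owned by only one of the two endpoints.
    ; output  = λ s nm → firstTrue {k} λ i →
        A.output (states s (self s * K + toℕ i)) (tripleName k W K nm (toℕ i))
    }

  -- Correctness of the simulation.

  module Correctness
    {n} (G : Hypergraph n) (graph : IsGraph G) {c} (I : Identifiers c n)
    (k≤W : k ≤ W)
    (degree≤ : ∀ v → k + degree G v ≤ W)
    (code<K : ∀ v → W + Identifiers.id I v < K) where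
    open Triples simulate G graph I k W K k≤W degree≤ code<K
    open Execution simulate G I
    open ExecutionProperties simulate G I

    module _ {c′} (idH-bounded : ∀ x → idH x < 2 ^ (c′ * ⌈log₂ n * W ⌉)) where
      open TripleExecution A {c′} idH-bounded

      record Simulates (t : ℕ) (v : Fin n) : Set where
        field
          self≡   : self (stateAfter t v) ≡ I.id v
          names≡  : names (stateAfter t v) ≡ map name (edgesOf v)
          states≡ : ∀ x → owner x ≡ v → states (stateAfter t v) (idH x) ≡ EH.stateAfter t x
      open Simulates

      -- The owner of `y` is either the receiving node or, by `owner∈`, the other endpoint of the
      -- underlying edge, whose message then arrives in this round.
      reported≡ : ∀ {t} → (∀ v → Simulates t v) → ∀ {x y h} → x ∈ edge H h → y ∈ edge H h →
        reportedState (states (stateAfter t (owner x))) (inbox (stateAfter t) (owner x)) (idH y)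
          ≡ EH.stateAfter t y
      reported≡ {t} sim {x} {y} {h} x∈ y∈ =
        reportedState≡ (inbox (stateAfter t) v) (All.tabulate correct) complete
        where
        v = owner x

        correct : ∀ {m} → m ∈ₗ inbox (stateAfter t) v → proj₁ (proj₂ m) ≡ idH y / K →
                  proj₂ (proj₂ m) (idH y) ≡ EH.stateAfter t y
        correct m∈ u≡ with e , u , refl ← ∈-inbox⁻ (stateAfter t) {v = v} m∈ =
          states≡ (sim u) y (sym (I.unique (trans u≡ (idH/K y))))

        complete : states (stateAfter t v) (idH y) ≡ EH.stateAfter t y ⊎
                   Any (λ (_ , u , _) → u ≡ idH y / K) (inbox (stateAfter t) v)
        complete with owner y Fin.≟ v
        ... | yes owner≡ = inj₁ (states≡ (sim v) y owner≡)
        ... | no owner≢ = inj₂ (lose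
          (∈-inbox⁺ (stateAfter t) {e = base h} (owner∈ x∈) (owner∈ y∈) owner≢) (sym (idH/K y)))

      simulates : ∀ t v → Simulates t v
      simulates zero v = record
        { self≡ = refl
        ; names≡ = refl
        ; states≡ = λ { x refl → cong (A.init (idH x)) (sym (namesH≡ x)) }
        }
      simulates (suc t) v = record
        { self≡ = self≡ (simulates t v)
        ; names≡ = names≡ (simulates t v)
        ; states≡ = λ { x refl → cong₂ A.receive (states≡ (simulates t v) x refl) (received x) }
        }
        where
        open ≡-Reasoning
        received : ∀ x → let v = owner x in
          inboxFrom A (reportedState (states (stateAfter t v)) (inbox (stateAfter t) v)) (idH x)
                    (tripleNames k W K (names (stateAfter t v)) (idH x))
            ≡ EH.inbox (EH.stateAfter t) x
        received x = begin
          inboxFrom A reported (idH x) (tripleNames k W K (names (stateAfter t (owner x))) (idH x))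
            ≡⟨ cong (λ nms → inboxFrom A reported (idH x) (tripleNames k W K nms (idH x)))
                 (names≡ (simulates t (owner x))) ⟩
          inboxFrom A reported (idH x) (tripleNames k W K (map name (edgesOf (owner x))) (idH x))
            ≡⟨ cong (inboxFrom A reported (idH x)) (namesH≡ x) ⟨
          inboxFrom A reported (idH x) (map EH.name (EH.edgesOf x))
            ≡⟨ PH.inbox≡ (EH.stateAfter t) x reported
                 (λ {_} {h} x∈ y∈ → reported≡ (simulates t) {h = h} x∈ y∈) ⟨
          EH.inbox (EH.stateAfter t) x ∎
          where
          reported : ID → A.State
          reported = reportedState
            (states (stateAfter t (owner x))) (inbox (stateAfter t) (owner x))

      output≡ : ∀ {M} → Execution.Outputs A H IH (lookup M) → ∀ {v e} → v ∈ edge G e → ∀ i →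
        A.output (states (stateAfter A.rounds v) (self (stateAfter A.rounds v) * K + toℕ i))
                 (tripleName k W K (name e) (toℕ i)) ≡ lookup M (pair e i)
      output≡ {M} outputs {v} {e} v∈e i = begin
        A.output (states s (self s * K + toℕ i)) (tripleName k W K (name e) (toℕ i))
          ≡⟨ cong (λ y → A.output (states s y) (tripleName k W K (name e) (toℕ i)))
               (trans (cong (λ a → a * K + toℕ i) (self≡ (simulates A.rounds v))) (sym (idH-copy v i))) ⟩
        A.output (states s (idH (copy v i))) (tripleName k W K (name e) (toℕ i))
          ≡⟨ cong₂ A.output (states≡ (simulates A.rounds v) (copy v i) (fst-pair v _))
               (sym (nameH-pair e i)) ⟩
        A.output (EH.stateAfter A.rounds (copy v i)) (EH.name (pair e i))
          ≡⟨ outputs (subst (copy v i ∈_) (sym (edge-pair e i)) (copy∈triple i v∈e)) ⟩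
        lookup M (pair e i) ∎
        where
        open ≡-Reasoning
        s = stateAfter A.rounds v

      edgeColoring : ∀ {Δ} → (∀ v → degree G v ≤ Δ) → Δ + Δ ≤ suc k →
        Σ[ M ∈ Subset (size H) ] (IsMaximalMatching H M × Execution.Outputs A H IH (lookup M)) →
        Σ[ χ ∈ (Fin (size G) → Fin k) ] (IsEdgeColoring G k χ × Outputs (λ e → toℕ (χ e)))
      edgeColoring degree≤Δ 2Δ≤1+k (M , M-maximal , M-outputs) =
        proj₁ ∘ matched , matchedColor-coloring degree≤Δ 2Δ≤1+k M-maximal , λ {v} {e} v∈e →
          firstTrue-unique _
            (trans (output≡ {M} M-outputs v∈e (proj₁ (matched e))) ([]=⇒lookup (proj₂ (matched e))))
            λ {j} out → matchedColor-unique degree≤Δ 2Δ≤1+k M-maximal e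
              (lookup⇒[]= (pair e j) M (trans (sym (output≡ {M} M-outputs v∈e j)) out))
        where
        matched : ∀ e → ∃[ i ] pair e i ∈ M
        matched = matchedColor degree≤Δ 2Δ≤1+k M-maximal

-- Length of the identifiers

-- Strong induction: `n` is at most twice its rounded-up half, whose logarithm is smaller by one.
n≤2^⌈log₂n⌉ : ∀ n → n ≤ 2 ^ ⌈log₂ n ⌉
n≤2^⌈log₂n⌉ = <-rec _ go
  where
  open ℕ.≤-Reasoning
  double : ∀ {l} → 1 ≤ l → 2 ^ (l ∸ 1) + 2 ^ (l ∸ 1) ≡ 2 ^ l
  double {suc l} _ = cong (2 ^ l +_) (sym (ℕ.+-identityʳ (2 ^ l)))
  go : ∀ n → (∀ {m} → m < n → m ≤ 2 ^ ⌈log₂ m ⌉) → n ≤ 2 ^ ⌈log₂ n ⌉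
  go zero          rec = z≤n
  go (suc zero)    rec = s≤s z≤n
  go n@(suc (suc m)) rec = begin
    n                                          ≡⟨ ℕ.⌊n/2⌋+⌈n/2⌉≡n n ⟨
    ⌊ n /2⌋ + ⌈ n /2⌉                          ≤⟨ ℕ.+-monoˡ-≤ ⌈ n /2⌉ (ℕ.⌊n/2⌋≤⌈n/2⌉ n) ⟩
    ⌈ n /2⌉ + ⌈ n /2⌉                          ≤⟨ ℕ.+-mono-≤ half half ⟩
    2 ^ (⌈log₂ n ⌉ ∸ 1) + 2 ^ (⌈log₂ n ⌉ ∸ 1)  ≡⟨ double (⌈log₂⌉-mono-≤ {2} {n} (s≤s (s≤s z≤n))) ⟩
    2 ^ ⌈log₂ n ⌉                              ∎
    where
    half : ⌈ n /2⌉ ≤ 2 ^ (⌈log₂ n ⌉ ∸ 1)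
    half = subst (λ l → ⌈ n /2⌉ ≤ 2 ^ l) (⌈log₂⌈n/2⌉⌉≡⌈log₂n⌉∸1 n) (rec (ℕ.⌈n/2⌉<n m))

-- Bounds a sum of powers of two by a product, so that exponents can be added.
m+n≤m*[m*n] : ∀ {m n} → 2 ≤ m → 1 ≤ n → m + n ≤ m * (m * n)
m+n≤m*[m*n] {m} {n} 2≤m 1≤n = begin
  m + n          ≡⟨ cong₂ _+_ (ℕ.*-identityʳ m) (ℕ.*-identityˡ n) ⟨
  m * 1 + 1 * n  ≤⟨ ℕ.+-mono-≤ (ℕ.*-monoʳ-≤ m 1≤n) (ℕ.*-monoˡ-≤ n (ℕ.≤-trans (s≤s z≤n) 2≤m)) ⟩
  m * n + m * n  ≡⟨ cong (m * n +_) (ℕ.+-identityʳ (m * n)) ⟨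
  2 * (m * n)    ≤⟨ ℕ.*-monoˡ-≤ (m * n) 2≤m ⟩
  m * (m * n)    ∎
  where open ℕ.≤-Reasoning

-- With `L` the rounded logarithm of the number of vertices, `W` is at most `2 ^ L` and `P` at most
-- `2 ^ (c * L)`. The identifiers stay below `P * (W + P)`, which yields the constant `c + (2 + c)`.
identifierBound : ∀ c {n W a s} → 1 ≤ n → 2 ≤ W → let P = 2 ^ (c * ⌈log₂ n ⌉) in
  a < P → s < W + P → a * (W + P) + s < 2 ^ ((c + (2 + c)) * ⌈log₂ n * W ⌉)
identifierBound c {n} {W} {a} {s} 1≤n 2≤W a<P s<K = begin-strict
  a * (W + P) + s        <⟨ ℕ.+-monoʳ-< (a * (W + P)) s<K ⟩
  a * (W + P) + (W + P)  ≡⟨ ℕ.+-comm _ (W + P) ⟩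
  suc a * (W + P)        ≤⟨ ℕ.*-monoˡ-≤ (W + P) a<P ⟩
  P * (W + P)            ≤⟨ ℕ.*-mono-≤ P≤Y (ℕ.+-mono-≤ W≤X P≤Y) ⟩
  Y * (X + Y)            ≤⟨ ℕ.*-monoʳ-≤ Y (m+n≤m*[m*n] (ℕ.≤-trans 2≤W W≤X) (ℕ.m^n>0 2 (c * L))) ⟩
  Y * (X * (X * Y))      ≡⟨ cong (λ z → Y * (X * z)) (ℕ.^-distribˡ-+-* 2 L (c * L)) ⟨
  Y * (X * 2 ^ (L + c * L))    ≡⟨ cong (Y *_) (ℕ.^-distribˡ-+-* 2 L (L + c * L)) ⟨
  Y * 2 ^ (L + (L + c * L))    ≡⟨ ℕ.^-distribˡ-+-* 2 (c * L) (L + (L + c * L)) ⟨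
  2 ^ (c * L + (2 + c) * L)    ≡⟨ cong (2 ^_) (ℕ.*-distribʳ-+ L c (2 + c)) ⟨
  2 ^ ((c + (2 + c)) * L) ∎
  where
  open ℕ.≤-Reasoning
  L = ⌈log₂ n * W ⌉
  P = 2 ^ (c * ⌈log₂ n ⌉)
  X = 2 ^ L
  Y = 2 ^ (c * L)
  W≤X : W ≤ X
  W≤X = ℕ.≤-trans (ℕ.m≤n*m W n {{>-nonZero 1≤n}}) (n≤2^⌈log₂n⌉ (n * W))
  P≤Y : P ≤ Y
  P≤Y = ℕ.^-monoʳ-≤ 2 (ℕ.*-monoʳ-≤ c
    (⌈log₂⌉-mono-≤ (ℕ.m≤m*n n W {{>-nonZero (ℕ.≤-trans (s≤s z≤n) 2≤W)}})))

-- The coloring algorithm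

silent : Algorithm ℕ
silent = record
  { State = ⊤ ; Message = ⊤ ; rounds = 0 ; init = λ _ _ → tt ; send = λ _ _ → tt
  ; receive = λ _ _ → tt ; output = λ _ _ → 0 }

-- For Δ = 0 the hypergraph would have no hyperedges, hence not have rank 3, and
-- nothing would be known about the number of rounds of A.
coloringAlgorithm : ℕ → (ℕ → ℕ → Algorithm Bool) → ℕ → ℕ → Algorithm ℕ
coloringAlgorithm c A n zero      = silent
coloringAlgorithm c A n Δ@(suc _) =
  Simulation.simulate (2 * Δ ∸ 1) (3 * Δ) (3 * Δ + 2 ^ (c * ⌈log₂ n ⌉))
    (A (n * (3 * Δ)) (2 * Δ ∸ 1))

coloringAlgorithm-correct : ∀ c T A → ComputesMaximalMatching (c + (2 + c)) 3 A T →
  ComputesEdgeColoring c (λ Δ → 2 * Δ ∸ 1) (coloringAlgorithm c A)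
    (λ n Δ → T (3 * n * Δ) (2 * Δ ∸ 1))
coloringAlgorithm-correct c T A A-correct n zero G graph Δ≡ I =
  -- For `Δ = 0` there are no colors, but no edges either.
  z≤n , (λ e → ⊥-elim (edgeless e)) , (λ {e} _ → ⊥-elim (edgeless e)) ,
    λ {_} {e} _ → ⊥-elim (edgeless e)
  where edgeless = maxDegree≡0⇒edgeless G Δ≡
coloringAlgorithm-correct c T A A-correct n Δ@(suc δ) G graph Δ≡ I =
  subst (λ N → Algorithm.rounds (A (n * W) k) ≤ T N k) N≡ (proj₁ matching) ,
  C.edgeColoring idH-bounded degree≤Δ 2Δ≤1+k (proj₂ matching)
  where
  -- At most `k + Δ = 3 * Δ - 1` slots of a node are occupied; with `3 * Δ` slots the number of
  -- vertices is the one in the round bound.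
  W = 3 * Δ
  k = 2 * Δ ∸ 1

  degree≤Δ : ∀ v → degree G v ≤ Δ
  degree≤Δ v = subst (degree G v ≤_) Δ≡ (degree≤maxDegree G v)

  Δ≤k : Δ ≤ k
  -- As `Δ` is `suc δ`, `k` computes to `δ + (Δ + 0)`.
  Δ≤k = ℕ.≤-trans (ℕ.≤-reflexive (sym (ℕ.+-identityʳ Δ))) (ℕ.m≤n+m (Δ + 0) δ)

  2Δ≤1+k : Δ + Δ ≤ suc k
  2Δ≤1+k = ℕ.≤-reflexive (cong (Δ +_) (sym (ℕ.+-identityʳ Δ)))

  k+Δ≤W : k + Δ ≤ W
  k+Δ≤W = ℕ.≤-trans (ℕ.+-monoˡ-≤ Δ (ℕ.m∸n≤m (2 * Δ) 1)) (ℕ.≤-reflexive (ℕ.+-comm (2 * Δ) Δ))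

  k≤W : k ≤ W
  k≤W = ℕ.≤-trans (ℕ.m≤m+n k Δ) k+Δ≤W

  slots : ∀ v → k + degree G v ≤ W
  slots v = ℕ.≤-trans (ℕ.+-monoʳ-≤ k (degree≤Δ v)) k+Δ≤W

  code<K : ∀ v → W + Identifiers.id I v < W + 2 ^ (c * ⌈log₂ n ⌉)
  code<K v = ℕ.+-monoʳ-< W (Identifiers.bounded I v)

  -- The exact rank and maximum degree require an edge; one exists because `Δ` is positive.
  e₀ : Fin (size G)
  e₀ = fromℕ< {0} (ℕ.<-≤-trans (s≤s z≤n) (subst (_≤ size G) Δ≡ (maxDegree≤size G)))

  module S = Simulation k W (W + 2 ^ (c * ⌈log₂ n ⌉)) (A (n * W) k)
  module C = S.Correctness G graph I k≤W slots code<K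
  open Triples S.simulate G graph I k W (W + 2 ^ (c * ⌈log₂ n ⌉)) k≤W slots code<K

  idH-bounded : ∀ x → idH x < 2 ^ ((c + (2 + c)) * ⌈log₂ n * W ⌉)
  -- The owner of `x` witnesses that `n` is positive.
  idH-bounded x = identifierBound c (ℕ.≤-<-trans z≤n (toℕ<n (owner x)))
    (ℕ.≤-trans (s≤s (s≤s z≤n)) (ℕ.*-monoʳ-≤ 3 (s≤s (z≤n {δ}))))
    (Identifiers.bounded I (owner x)) (code< x)

  open TripleExecution (A (n * W) k) {c + (2 + c)} idH-bounded

  matching : Algorithm.rounds (A (n * W) k) ≤ T (n * W) k ×
    Σ[ M ∈ Subset (size H) ]
      (IsMaximalMatching H M × Execution.Outputs (A (n * W) k) H IH (lookup M))
  matching = A-correct (n * W) k H (rank≡3 (pair e₀ (fromℕ< (ℕ.≤-trans (s≤s z≤n) Δ≤k))))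
    (maxDegreeH≡k e₀ (λ v → ℕ.≤-trans (degree≤Δ v) Δ≤k)) IH

  N≡ : n * (3 * Δ) ≡ 3 * n * Δ
  N≡ = trans (sym (ℕ.*-assoc n 3 Δ)) (cong (_* Δ) (ℕ.*-comm n 3))

lemma1p3 : ∀ (c : ℕ) → Σ[ c′ ∈ ℕ ]
    (∀ (T : ℕ → ℕ → ℕ) (A : ℕ → ℕ → Algorithm Bool) →
    ComputesMaximalMatching c′ 3 A T →
    Σ[ B ∈ (ℕ → ℕ → Algorithm ℕ) ]
    ComputesEdgeColoring c (λ Δ → 2 * Δ ∸ 1) B
    (λ n Δ → T (3 * n * Δ) (2 * Δ ∸ 1)))
lemma1p3 c = c + (2 + c) , λ T A A-correct →
  coloringAlgorithm c A , coloringAlgorithm-correct c T A A-correct
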